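{- Let $G$ be a pawful graph, i.e. a finite simple undirected connected graph of diameter at most $2$ such that for any three vertices $u,v,w$ with $d(u,v)=d(v,w)=2$ and $d(u,w)=1$ there exists a vertex $x$ with $d(x,u)=d(x,v)=d(x,w)=1$. Then $G$ is diagonal, i.e. $\mathrm{MH}_{k,l}(G)\neq 0$ only if $k=l$.
   Context: For a finite simple undirected connected graph $G$, $d$ denotes the shortest-path metric on $V(G)$. For a tuple of vertices $(x_0,\ldots,x_k)$ put $\ell(x_0,\ldots,x_k)=\sum_{i=0}^{k-1} d(x_i,x_{i+1})$. The magnitude chain complex has $\mathrm{MC}_{k,l}(G)$ equal to the free abelian group on the tuples $(x_0,\ldots,x_k)\in V(G)^{k+1}$ with $x_i\neq x_{i+1}$ for all $i$ and $\ell(x_0,\ldots,x_k)=l$, with differential $\partial=\sum_{1\le i\le k-1}(-1)^i\partial_i:\mathrm{MC}_{k,l}(G)\to \mathrm{MC}_{k-1,l}(G)$, where $\partial_i(x_0,\ldots,x_k)=(x_0,\ldots,\hat x_i,\ldots,x_k)$ if $\ell(x_0,\ldots,\hat x_i,\ldots,x_k)=\ell(x_0,\ldots,x_k)$ and $0$ otherwise. Magnitude homology is $\mathrm{MH}_{k,l}(G)=H_k(\mathrm{MC}_{*,l}(G))$. A graph is diagonal if $\mathrm{MH}_{k,l}(G)\ne 0$ only when $k=l$. -}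

module Defs where

open import Data.Nat using (ℕ; zero; suc; _≤_) renaming (_+_ to _+ℕ_)
open import Data.Nat.Properties using () renaming (_≟_ to _≟ℕ_)
open import Data.Integer using (ℤ; 0ℤ; 1ℤ; _+_; _*_; -_)
open import Data.Fin using (Fin; zero; suc; toℕ; inject₁)
open import Data.Fin.Properties using () renaming (_≟_ to _≟F_)
open import Data.Vec using (Vec; []; _∷_; removeAt)
open import Data.Vec.Properties using (≡-dec)
open import Data.List using (List; []; _∷_; map; concatMap; foldr; allFin)
open import Data.Product using (Σ; ∃; _×_; _,_)
open import Relation.Binary.PropositionalEquality using (_≡_; _≢_)
open import Relation.Nullary using (¬_; yes; no)
open import Relation.Nullary.Decidable using (_×-dec_)

record SimpleGraph : Set₁ where
  field
    n         : ℕ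
    Adj       : Fin n → Fin n → Set
    Adj-sym   : ∀ {x y} → Adj x y → Adj y x
    Adj-irrefl : ∀ {x} → ¬ Adj x x

module _ (G : SimpleGraph) where
  open SimpleGraph G

  data Walk : Fin n → Fin n → ℕ → Set where
    here : ∀ {x} → Walk x x 0
    step : ∀ {x z y m} → Adj x z → Walk z y m → Walk x y (suc m)

  -- d is the shortest-path metric of G: d x y is the length of some walk
  -- from x to y, and no walk from x to y is shorter.  (The existence of
  -- walks for all x, y is exactly connectedness of G.)
  IsShortestPathMetric : (Fin n → Fin n → ℕ) → Set
  IsShortestPathMetric d =
    ∀ x y → Walk x y (d x y) × (∀ m → Walk x y m → d x y ≤ m)

module _ {n : ℕ} (d : Fin n → Fin n → ℕ) where

  Pawful : Set
  Pawful =
    (∀ u v → d u v ≤ 2) ×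
    (∀ u v w → d u v ≡ 2 → d v w ≡ 2 → d u w ≡ 1 →
       ∃ λ x → d x u ≡ 1 × d x v ≡ 1 × d x w ≡ 1)

module Magnitude {n : ℕ} (d : Fin n → Fin n → ℕ) where

  V : Set
  V = Fin n

  Tuple : ℕ → Set
  Tuple k = Vec V (suc k)

  len : ∀ {k} → Tuple k → ℕ
  len {zero}  (x ∷ [])     = 0
  len {suc k} (x ∷ y ∷ xs) = d x y +ℕ len (y ∷ xs)

  NoRepeat : ∀ {k} → Tuple k → Set
  NoRepeat {zero}  (x ∷ [])     = Data.Unit.⊤ where import Data.Unit
  NoRepeat {suc k} (x ∷ y ∷ xs) = x ≢ y × NoRepeat (y ∷ xs)

  Gen : (k l : ℕ) → Tuple k → Set
  Gen k l x = NoRepeat x × len x ≡ l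

  -- a chain in MC_{k,l}(G): an integer coefficient for each generator
  -- (the generating set is finite, so every such function has finite
  -- support); coefficients of non-generators are required to vanish.
  Chain : (k l : ℕ) → Set
  Chain k l = Σ (Tuple k → ℤ) λ c → ∀ x → ¬ Gen k l x → c x ≡ 0ℤ

  coeff : ∀ {k l} → Chain k l → Tuple k → ℤ
  coeff (c , _) = c

  allVecs : (m : ℕ) → List (Vec V m)
  allVecs zero    = [] ∷ []
  allVecs (suc m) = concatMap (λ v → map (_∷ v) (allFin n)) (allVecs m)

  sumℤ : List ℤ → ℤ
  sumℤ = foldr _+_ 0ℤ

  sign : ℕ → ℤ
  sign zero          = 1ℤ
  sign (suc zero)    = - 1ℤ
  sign (suc (suc i)) = sign i

  -- coefficient of y in ∂_i x, where i = 1 + toℕ j (an inner index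
  -- 1 ≤ i ≤ k of a tuple x of length k+2): ∂_i x = x with x_i removed
  -- if this preserves ℓ, and 0 otherwise
  face-coeff : ∀ {k} → Fin k → Tuple (suc k) → Tuple k → ℤ
  face-coeff j x y with len (removeAt x (suc (inject₁ j))) ≟ℕ len x
                      ×-dec ≡-dec _≟F_ (removeAt x (suc (inject₁ j))) y
  ... | yes _ = 1ℤ
  ... | no  _ = 0ℤ

  ∂-coeff : ∀ {k} → Tuple (suc k) → Tuple k → ℤ
  ∂-coeff {k} x y =
    sumℤ (map (λ j → sign (suc (toℕ j)) * face-coeff j x y) (allFin k))

  ∂ : ∀ {k l} → Chain (suc k) l → Tuple k → ℤ
  ∂ {k} c y = sumℤ (map (λ x → coeff c x * ∂-coeff x y) (allVecs (suc (suc k))))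

  -- cycles of MC_{k,l}; the differential out of degree 0 is zero
  IsCycle : ∀ {k l} → Chain k l → Set
  IsCycle {zero}  c = Data.Unit.⊤ where import Data.Unit
  IsCycle {suc k} c = ∀ y → ∂ c y ≡ 0ℤ

  IsBoundary : ∀ {k l} → Chain k l → Set
  IsBoundary {k} {l} c = Σ (Chain (suc k) l) λ b → ∀ y → ∂ b y ≡ coeff c y

  MH-vanishes : ℕ → ℕ → Set
  MH-vanishes k l = ∀ (c : Chain k l) → IsCycle c → IsBoundary c

  Diagonal : Set
  Diagonal = ∀ k l → k ≢ l → MH-vanishes k l

{-# OPTIONS --safe #-}
module Submission where

-- The pairs p → x, graded by d p x, span an algebra in which concatenation is
-- nonzero exactly when distances add; the magnitude complex is its bar complex, so
-- diagonality is Koszulness.  Pawfulness provides a Koszul filtration: the ideals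
-- generated by sets S of edges p → s.  Adding a generator p → q to S, the colon
-- ideal is generated by the edges q → t with d p t ≤ 1 or t adjacent to S; that these
-- generate everything in degree 2 is the pawful condition.  Exactness off the
-- diagonal follows by induction on the homological degree and then on S.

open import Defs
open import Data.Empty using (⊥-elim)
open import Data.Fin using (Fin; zero; suc; toℕ; inject₁)
open import Data.Fin.Properties using () renaming (_≟_ to _≟F_)
open import Data.Integer using (ℤ; 0ℤ; 1ℤ; -1ℤ; _+_; _*_)
open import Data.Integer.Properties using (+-identityˡ; +-identityʳ; *-zeroˡ; *-zeroʳ; *-identityˡ; *-distribˡ-+; *-comm)
open import Data.Integer.Tactic.RingSolver using (solve-∀)
open import Data.List using (List; []; _∷_; _++_; map; concatMap; allFin; filter; foldr)
open import Data.List.Properties using (map-tabulate)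
open import Data.List.Membership.Propositional using (_∈_; lose)
open import Data.List.Membership.Propositional.Properties using (∈-filter⁺; ∈-filter⁻; ∈-allFin)
open import Data.List.Relation.Unary.All using (All; []; _∷_) renaming (tabulate to All-tabulate)
open import Data.List.Relation.Unary.Any using (Any; any?; here; there)
open import Data.Nat using (ℕ; zero; suc; _≤_; _≤?_; z≤n; s≤s) renaming (_+_ to _+ℕ_)
open import Data.Nat.Properties using (≤-antisym; n≤0⇒n≡0; +-cancelˡ-≡; +-cancelʳ-≡; +-assoc; +-suc) renaming (_≟_ to _≟ℕ_)
open import Data.Product using (Σ; ∃; _×_; _,_; proj₁; proj₂)
open import Data.Sum using (_⊎_; inj₁; inj₂)
open import Data.Unit using (⊤; tt)
open import Data.Vec using (Vec; []; _∷_; removeAt)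
open import Data.Vec.Properties using (≡-dec; ∷-injectiveˡ; ∷-injectiveʳ)
open import Function using (_∘_)
open import Relation.Binary.PropositionalEquality using (_≡_; _≢_; refl; sym; trans; cong; cong₂; subst)
open import Relation.Nullary using (¬_; Dec; yes; no)
open import Relation.Nullary.Decidable using (_×-dec_; _⊎-dec_; ¬?)

-- Finite integer sums.

module Sums where

  sumℤ : List ℤ → ℤ
  sumℤ = foldr _+_ 0ℤ

  ∑ : ∀ {A : Set} → List A → (A → ℤ) → ℤ
  ∑ xs f = sumℤ (map f xs)

  module _ {A : Set} where

    ∑-cong : ∀ (xs : List A) {f g : A → ℤ} → (∀ x → f x ≡ g x) → ∑ xs f ≡ ∑ xs g
    ∑-cong []       eq = refl
    ∑-cong (x ∷ xs) eq = cong₂ _+_ (eq x) (∑-cong xs eq)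

    ∑-zero : ∀ (xs : List A) {f : A → ℤ} → (∀ x → f x ≡ 0ℤ) → ∑ xs f ≡ 0ℤ
    ∑-zero []       eq = refl
    ∑-zero (x ∷ xs) eq = cong₂ _+_ (eq x) (∑-zero xs eq)

    ∑-scale : ∀ (xs : List A) (f : A → ℤ) m → ∑ xs (λ x → m * f x) ≡ m * ∑ xs f
    ∑-scale []       f m = sym (*-zeroʳ m)
    ∑-scale (x ∷ xs) f m = trans (cong (m * f x +_) (∑-scale xs f m)) (sym (*-distribˡ-+ m (f x) (∑ xs f)))

    ∑-linear : ∀ (xs : List A) (f g : A → ℤ) m →
               ∑ xs (λ x → f x + m * g x) ≡ ∑ xs f + m * ∑ xs g
    ∑-linear []       f g m = sym (trans (+-identityˡ (m * 0ℤ)) (*-zeroʳ m))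
    ∑-linear (x ∷ xs) f g m = trans (cong (f x + m * g x +_) (∑-linear xs f g m))
                                    (rearrange (f x) (g x) (∑ xs f) (∑ xs g) m)
      where
      rearrange : ∀ a b s t m → (a + m * b) + (s + m * t) ≡ (a + s) + m * (b + t)
      rearrange = solve-∀

    ∑-++ : ∀ (xs ys : List A) (f : A → ℤ) → ∑ (xs ++ ys) f ≡ ∑ xs f + ∑ ys f
    ∑-++ []       ys f = sym (+-identityˡ _)
    ∑-++ (x ∷ xs) ys f = trans (cong (f x +_) (∑-++ xs ys f)) (assoc (f x) (∑ xs f) (∑ ys f))
      where
      assoc : ∀ a b c → a + (b + c) ≡ (a + b) + c
      assoc = solve-∀

  ∑-map : ∀ {A B : Set} (xs : List A) (h : A → B) (f : B → ℤ) → ∑ (map h xs) f ≡ ∑ xs (f ∘ h)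
  ∑-map []       h f = refl
  ∑-map (x ∷ xs) h f = cong (f (h x) +_) (∑-map xs h f)

  ∑-concatMap : ∀ {A B : Set} (xs : List A) (h : A → List B) (f : B → ℤ) →
                ∑ (concatMap h xs) f ≡ ∑ xs (λ x → ∑ (h x) f)
  ∑-concatMap []       h f = refl
  ∑-concatMap (x ∷ xs) h f = trans (∑-++ (h x) (concatMap h xs) f)
                                   (cong (∑ (h x) f +_) (∑-concatMap xs h f))

  ∑-allFin-suc : ∀ n (f : Fin (suc n) → ℤ) → ∑ (allFin (suc n)) f ≡ f zero + ∑ (allFin n) (f ∘ suc)
  ∑-allFin-suc n f = cong (λ t → f zero + sumℤ t)
    (trans (map-tabulate suc f) (sym (map-tabulate (λ i → i) (f ∘ suc))))

  ∑-allFin-single : ∀ n (i : Fin n) (f : Fin n → ℤ) → (∀ j → j ≢ i → f j ≡ 0ℤ) → ∑ (allFin n) f ≡ f i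
  ∑-allFin-single (suc n) zero f off =
    trans (∑-allFin-suc n f)
    (trans (cong (f zero +_) (∑-zero (allFin n) (λ j → off (suc j) λ ()))) (+-identityʳ (f zero)))
  ∑-allFin-single (suc n) (suc i) f off =
    trans (∑-allFin-suc n f)
    (trans (cong₂ _+_ (off zero λ ())
                      (∑-allFin-single n i (f ∘ suc) (λ j j≢i → off (suc j) λ { refl → j≢i refl })))
           (+-identityˡ (f (suc i))))

open Sums using (∑; ∑-cong; ∑-zero; ∑-scale; ∑-linear; ∑-map; ∑-concatMap; ∑-allFin-suc; ∑-allFin-single)

-- Indicators of decidable propositions.

indicator : ∀ {P : Set} → Dec P → ℤ
indicator (yes _) = 1ℤ
indicator (no  _) = 0ℤ

indicator-yes : ∀ {P : Set} (P? : Dec P) → P → indicator P? ≡ 1ℤ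
indicator-yes (yes _) p = refl
indicator-yes (no ¬p) p = ⊥-elim (¬p p)

indicator-no : ∀ {P : Set} (P? : Dec P) → ¬ P → indicator P? ≡ 0ℤ
indicator-no (yes p) ¬p = ⊥-elim (¬p p)
indicator-no (no _)  ¬p = refl

indicator-cong : ∀ {P Q : Set} (P? : Dec P) (Q? : Dec Q) → (P → Q) → (Q → P) → indicator P? ≡ indicator Q?
indicator-cong (yes p) Q? to from = sym (indicator-yes Q? (to p))
indicator-cong (no ¬p) Q? to from = sym (indicator-no Q? (¬p ∘ from))

indicator-× : ∀ {P Q : Set} (P? : Dec P) (Q? : Dec Q) → indicator (P? ×-dec Q?) ≡ indicator P? * indicator Q?
indicator-× (yes _) (yes _) = refl
indicator-× (yes _) (no _)  = refl
indicator-× (no _)  Q?      = sym (*-zeroˡ (indicator Q?))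

indicator-*-zero : ∀ {P : Set} (P? : Dec P) {z} → (P → z ≡ 0ℤ) → indicator P? * z ≡ 0ℤ
indicator-*-zero (yes p) {z} z≡0 = trans (*-identityˡ z) (z≡0 p)
indicator-*-zero (no _)  {z} z≡0 = *-zeroˡ z

indicator-yes-* : ∀ {P : Set} (P? : Dec P) {z} → P → indicator P? * z ≡ z
indicator-yes-* P? {z} p = trans (cong (_* z) (indicator-yes P? p)) (*-identityˡ z)

indicator-no-* : ∀ {P : Set} (P? : Dec P) {z} → ¬ P → indicator P? * z ≡ 0ℤ
indicator-no-* P? ¬p = indicator-*-zero P? (λ p → ⊥-elim (¬p p))

-- The differential on tuples with a fixed head.

module Differential {n : ℕ} (d : Fin n → Fin n → ℕ) where
  open Magnitude d using (V)

  Between : V → V → V → Set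
  Between p u x = d p u ≡ 1 × d u x ≡ 1 × d p x ≡ 2

  between? : ∀ p u x → Dec (Between p u x)
  between? p u x = d p u ≟ℕ 1 ×-dec d u x ≟ℕ 1 ×-dec d p x ≟ℕ 2

  w : V → V → V → ℤ
  w p u x = indicator (between? p u x)

  ins : ∀ {k} → V → (Vec V (suc (suc k)) → ℤ) → V → Vec V k → ℤ
  ins p c x r = ∑ (allFin n) (λ u → w p u x * c (u ∷ x ∷ r))

  -- On chains of tuples starting at p (the head p being omitted), D p is
  -- −∂ in diameter 2, where a face is nonzero only when steps 1, 1 merge into a step 2.
  D : ∀ {k} → V → (Vec V (suc k) → ℤ) → Vec V k → ℤ
  D p c []      = 0ℤ
  D p c (x ∷ r) = ins p c x r + -1ℤ * D x (c ∘ (x ∷_)) r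

  D-cong : ∀ {k} p {c c′ : Vec V (suc k) → ℤ} → (∀ r → c r ≡ c′ r) → ∀ r → D p c r ≡ D p c′ r
  D-cong p eq []      = refl
  D-cong p eq (x ∷ r) = cong₂ (λ a b → a + -1ℤ * b)
    (∑-cong (allFin n) (λ u → cong (w p u x *_) (eq (u ∷ x ∷ r))))
    (D-cong x (eq ∘ (x ∷_)) r)

  D-zero : ∀ {k} p {c : Vec V (suc k) → ℤ} → (∀ r → c r ≡ 0ℤ) → ∀ r → D p c r ≡ 0ℤ
  D-zero p eq []      = refl
  D-zero p eq (x ∷ r) = cong₂ (λ a b → a + -1ℤ * b)
    (∑-zero (allFin n) (λ u → trans (cong (w p u x *_) (eq (u ∷ x ∷ r))) (*-zeroʳ (w p u x))))
    (D-zero x (eq ∘ (x ∷_)) r)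

  -- The shape `c + m * c′` serves sums and differences, with `m` equal to `1ℤ` or `-1ℤ`, and
  -- multiples, with `c` zero.
  D-linear : ∀ {k} p (c c′ : Vec V (suc k) → ℤ) m r →
             D p (λ s → c s + m * c′ s) r ≡ D p c r + m * D p c′ r
  D-linear p c c′ m []      = sym (trans (+-identityˡ (m * 0ℤ)) (*-zeroʳ m))
  D-linear p c c′ m (x ∷ r) =
    trans (cong₂ (λ a b → a + -1ℤ * b)
            (trans (∑-cong (allFin n) (λ u → distrib (w p u x) (c (u ∷ x ∷ r)) (c′ (u ∷ x ∷ r)) m))
                   (∑-linear (allFin n) (λ u → w p u x * c (u ∷ x ∷ r)) (λ u → w p u x * c′ (u ∷ x ∷ r)) m))
            (D-linear x (c ∘ (x ∷_)) (c′ ∘ (x ∷_)) m r))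
          (rearrange (ins p c x r) (ins p c′ x r) (D x (c ∘ (x ∷_)) r) (D x (c′ ∘ (x ∷_)) r) m)
    where
    distrib : ∀ t a b m → t * (a + m * b) ≡ t * a + m * (t * b)
    distrib = solve-∀
    rearrange : ∀ a a′ b b′ m → (a + m * a′) + -1ℤ * (b + m * b′) ≡ (a + -1ℤ * b) + m * (a′ + -1ℤ * b′)
    rearrange = solve-∀

  D-scale : ∀ {k} p (c : Vec V (suc k) → ℤ) m r → D p (λ s → m * c s) r ≡ m * D p c r
  D-scale p c m r =
    trans (D-cong p (λ s → sym (+-identityˡ (m * c s))) r)
    (trans (D-linear p (λ _ → 0ℤ) c m r)
    (trans (cong (_+ m * D p c r) (D-zero p (λ _ → refl) r)) (+-identityˡ (m * D p c r))))

  D-∑ : ∀ {A : Set} {k} p (us : List A) (a : A → ℤ) (c : A → Vec V (suc k) → ℤ) r →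
        D p (λ s → ∑ us (λ u → a u * c u s)) r ≡ ∑ us (λ u → a u * D p (c u) r)
  D-∑ p []       a c r = D-zero p (λ _ → refl) r
  D-∑ p (u ∷ us) a c r =
    trans (D-cong p (λ s → swap (a u * c u s) (∑ us (λ v → a v * c v s))) r)
    (trans (D-linear p (λ s → ∑ us (λ v → a v * c v s)) (c u) (a u) r)
    (trans (cong (_+ a u * D p (c u) r) (D-∑ p us a c r))
           (swap (∑ us (λ v → a v * D p (c v) r)) (a u * D p (c u) r))))
    where
    swap : ∀ a b → a + b ≡ b + a
    swap = solve-∀

  -- Merging into the step `p → x` commutes with differentiating behind `x`, so the two mixed terms
  -- both equal `common` and cancel. Differentiating twice behind `x` gives zero by recursion.
  D∘D≡0 : ∀ {k} p (c : Vec V (suc (suc k)) → ℤ) r → D p (D p c) r ≡ 0ℤ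
  D∘D≡0 p c []      = refl
  D∘D≡0 p c (x ∷ r) =
    trans (cong₂ (λ a b → a + -1ℤ * b) inner outer) (cancel common)
    where
    common : ℤ
    common = ∑ (allFin n) (λ u → w p u x * D x (λ s → c (u ∷ x ∷ s)) r)

    cancel : ∀ a → a + -1ℤ * a ≡ 0ℤ
    cancel = solve-∀

    expand : ∀ a b e → a ≡ 0ℤ → b ≡ 0ℤ → a + -1ℤ * (b + -1ℤ * e) ≡ e
    expand a b e refl refl = simplify e
      where
      simplify : ∀ e → 0ℤ + -1ℤ * (0ℤ + -1ℤ * e) ≡ e
      simplify = solve-∀

    -- A merged step has length 2, so it cannot be merged again.
    term : ∀ u → w p u x * D p c (u ∷ x ∷ r) ≡ w p u x * D x (λ s → c (u ∷ x ∷ s)) r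
    term u with between? p u x
    ... | no _ = refl
    ... | yes (pu , ux , _) = cong (1ℤ *_) (expand _ _ _
      (∑-zero (allFin n) λ t → indicator-no-* (between? p t u)
        λ (_ , _ , pu≡2) → 1≢2 (trans (sym pu) pu≡2))
      (∑-zero (allFin n) λ t → indicator-no-* (between? u t x)
        λ (_ , _ , ux≡2) → 1≢2 (trans (sym ux) ux≡2)))
      where
      1≢2 : 1 ≢ 2
      1≢2 ()

    inner : ins p (D p c) x r ≡ common
    inner = ∑-cong (allFin n) term

    outer : D x (λ s → D p c (x ∷ s)) r ≡ common
    outer =
      trans (D-linear x (ins p c x) (D x (c ∘ (x ∷_))) -1ℤ r)
      (trans (cong₂ (λ a b → a + -1ℤ * b)
               (D-∑ x (allFin n) (λ u → w p u x) (λ u s → c (u ∷ x ∷ s)) r)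
               (D∘D≡0 x (c ∘ (x ∷_)) r))
             (+-identityʳ common))

-- Off-diagonal exactness for ideals generated by edges.

module Contraction {n : ℕ} (d : Fin n → Fin n → ℕ)
  (d-refl : ∀ x → d x x ≡ 0)
  (d-sep : ∀ {x y} → d x y ≡ 0 → x ≡ y)
  (d-sym : ∀ x y → d x y ≡ d y x)
  (pawful : Pawful d)
  where

  open Magnitude d using (V; len; NoRepeat)
  open Differential d

  distance : ∀ x y → x ≡ y ⊎ d x y ≡ 1 ⊎ d x y ≡ 2
  distance x y with d x y in eq | proj₁ pawful x y
  ... | 0 | _ = inj₁ (d-sep eq)
  ... | 1 | _ = inj₂ (inj₁ refl)
  ... | 2 | _ = inj₂ (inj₂ refl)
  ... | suc (suc (suc _)) | s≤s (s≤s ())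

  1≢2 : ∀ {m} → m ≡ 1 → m ≢ 2
  1≢2 refl ()

  positive⇒≢ : ∀ {x y m} → d x y ≡ suc m → x ≢ y
  positive⇒≢ {x} eq refl with () ← trans (sym (d-refl x)) eq

  -- The length is constrained by a predicate L rather than fixed to l, so that passing
  -- to a tail replaces L by L ∘ (m +_) instead of subtracting m from l.
  Lies : (ℕ → Set) → V → ∀ {k} → Vec V k → Set
  Lies L p r = NoRepeat (p ∷ r) × L (len (p ∷ r))

  Graded : (ℕ → Set) → V → ∀ {k} → (Vec V k → ℤ) → Set
  Graded L p c = ∀ r → ¬ Lies L p r → c r ≡ 0ℤ

  D-graded : ∀ L p {k} (c : Vec V (suc k) → ℤ) → Graded L p c → Graded L p (D p c)
  D-graded L p c gr []      _    = refl
  D-graded L p c gr (x ∷ r) ¬lies = cong₂ (λ a b → a + -1ℤ * b)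
    (∑-zero (allFin n) λ u → indicator-*-zero (between? p u x)
      λ btw → gr (u ∷ x ∷ r) (¬lies ∘ merge u btw))
    later
    where
    merge : ∀ u → Between p u x → Lies L p (u ∷ x ∷ r) → Lies L p (x ∷ r)
    merge u (pu , ux , px) ((_ , _ , nr) , len∈L) =
      (positive⇒≢ px , nr) ,
      subst L (trans (cong₂ (λ a b → a +ℕ (b +ℕ len (x ∷ r))) pu ux) (cong (_+ℕ len (x ∷ r)) (sym px))) len∈L

    later : D x (c ∘ (x ∷_)) r ≡ 0ℤ
    -- If `p ≡ x`, every `p ∷ x ∷ s` has a repeat and the grading kills `c` outright; otherwise
    -- `p ≢ x` is what `Lies` at `x` lacks.
    later with p ≟F x
    ... | yes p≡x = D-zero x (λ s → gr (x ∷ s) λ ((p≢x , _) , _) → p≢x p≡x) r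
    ... | no p≢x  = D-graded (L ∘ (d p x +ℕ_)) x (c ∘ (x ∷_))
      (λ s ¬lies′ → gr (x ∷ s) λ ((_ , nr) , len∈L) → ¬lies′ (nr , len∈L)) r
      (λ (nr , len∈L) → ¬lies ((p≢x , nr) , len∈L))

  AdjacentTo : List V → V → Set
  AdjacentTo S x = Any (λ s → d s x ≡ 1) S

  -- With the product (p → x)(x → y) = (p → y) when d p x + d x y = d p y and 0 otherwise,
  -- these p → x span the right ideal generated by the edges p → s, s ∈ S.
  Allowed : V → List V → V → Set
  Allowed p S x = x ∈ S ⊎ (d p x ≡ 2 × AdjacentTo S x)

  AllowedHead : V → List V → ∀ {k} → Vec V k → Set
  AllowedHead p S []      = ⊤
  AllowedHead p S (x ∷ r) = Allowed p S x

  SupportedOn : V → List V → ∀ {k} → (Vec V k → ℤ) → Set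
  SupportedOn p S c = ∀ r → ¬ AllowedHead p S r → c r ≡ 0ℤ

  Cycle : V → ∀ {k} → (Vec V k → ℤ) → Set
  Cycle p {zero}  c = ⊤
  Cycle p {suc k} c = ∀ r → D p c r ≡ 0ℤ

  Filling : (ℕ → Set) → V → List V → ∀ {k} → (Vec V k → ℤ) → Set
  Filling L p S {k} c = Σ (Vec V (suc k) → ℤ) λ b →
    Graded L p b × SupportedOn p S b × (∀ r → D p b r ≡ c r)

  -- `¬ L k` is the off-diagonal condition. Over all `k`, this is the bar-complex form of having a
  -- linear resolution; `L` and `p` vary because the induction passes to `L ∘ suc` and to the head
  -- `q`.
  Exact : ℕ → Set₁
  Exact k = ∀ (L : ℕ → Set) → ¬ L k → ∀ p S → All (λ s → d p s ≡ 1) S →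
    ∀ (c : Vec V k → ℤ) → Graded L p c → SupportedOn p S c → Cycle p c → Filling L p S c

  zero-filling : ∀ L p S {k} (c : Vec V k → ℤ) → (∀ r → c r ≡ 0ℤ) → Filling L p S c
  zero-filling L p S c c≡0 =
    (λ _ → 0ℤ) , (λ _ _ → refl) , (λ _ _ → refl) ,
    λ r → trans (D-zero p (λ _ → refl) r) (sym (c≡0 r))

  -- The witness is `p` if `y` is adjacent to `p`, and otherwise the vertex that the pawful
  -- condition gives for `q`, `y`, `p`. It puts each `q → y` of length 2 into the ideal generated by
  -- the colon edges.
  common-neighbour : ∀ {p q y} → d p q ≡ 1 → d q y ≡ 2 →
    ∃ λ t → d q t ≡ 1 × d p t ≤ 1 × d t y ≡ 1
  common-neighbour {p} {q} {y} pq qy with distance p y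
  ... | inj₁ refl = ⊥-elim (1≢2 (trans (d-sym q p) pq) qy)
  ... | inj₂ (inj₁ py) = p , trans (d-sym q p) pq , subst (_≤ 1) (sym (d-refl p)) z≤n , py
  ... | inj₂ (inj₂ py)
    with t , tq , ty , tp ← proj₂ pawful q y p qy (trans (d-sym y p) py) (trans (d-sym q p) pq)
    = t , trans (d-sym q t) tq , subst (_≤ 1) (sym (trans (d-sym p t) tp)) (s≤s z≤n) , ty

  -- Induction step: splitting the generator `q` off `q ∷ S`.

  module Step {k : ℕ} (exact : Exact k) (L : ℕ → Set) (¬Lk : ¬ L (suc k))
    (p q : V) (pq : d p q ≡ 1) (S : List V)
    (c : Vec V (suc k) → ℤ) (gr : Graded L p c) (sup : SupportedOn p (q ∷ S) c) (cyc : Cycle p c)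
    where

    L′ : ℕ → Set
    L′ = L ∘ suc

    -- q → t is a generator of the colon ideal of p → q modulo the ideal of S.
    Colon : V → Set
    Colon t = d q t ≡ 1 × (d p t ≤ 1 ⊎ AdjacentTo S t)

    colon? : ∀ t → Dec (Colon t)
    colon? t = d q t ≟ℕ 1 ×-dec (d p t ≤? 1 ⊎-dec any? (λ s → d s t ≟ℕ 1) S)

    T : List V
    T = filter colon? (allFin n)

    ∈T⁺ : ∀ {t} → Colon t → t ∈ T
    ∈T⁺ {t} = ∈-filter⁺ colon? (∈-allFin t)

    ∈T⁻ : ∀ {t} → t ∈ T → Colon t
    ∈T⁻ t∈T = proj₂ (∈-filter⁻ colon? {xs = allFin n} t∈T)

    -- What `q` adds to the ideal of `S`, apart from `p → q` itself.
    New : V → Set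
    New x = d p x ≡ 2 × d q x ≡ 1 × ¬ AdjacentTo S x

    new? : ∀ x → Dec (New x)
    new? x = d p x ≟ℕ 2 ×-dec d q x ≟ℕ 1 ×-dec ¬? (any? (λ s → d s x ≟ℕ 1) S)

    new-not-allowed : ∀ {x} → New x → ¬ Allowed q T x
    new-not-allowed (px , qx , ¬adj) (inj₁ x∈T) with ∈T⁻ x∈T
    ... | _ , inj₁ px≤1 with s≤s () ← subst (_≤ 1) px px≤1
    ... | _ , inj₂ adj = ¬adj adj
    new-not-allowed (px , qx , ¬adj) (inj₂ (qx≡2 , _)) = 1≢2 qx qx≡2

    -- With `new-not-allowed`, this identifies the ideal of `T` as the colon ideal. Distance 2 from
    -- `q` is covered by `common-neighbour`; at distance 1, each way of failing to be new is an
    -- alternative in `Colon`.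
    not-allowed-new : ∀ {x} → q ≢ x → ¬ Allowed q T x → New x
    not-allowed-new {x} q≢x ¬al with distance q x
    ... | inj₁ q≡x = ⊥-elim (q≢x q≡x)
    ... | inj₂ (inj₂ qx) with t , qt , pt , tx ← common-neighbour pq qx =
      ⊥-elim (¬al (inj₂ (qx , lose (∈T⁺ (qt , inj₁ pt)) tx)))
    ... | inj₂ (inj₁ qx) with distance p x
    ...   | inj₁ refl = ⊥-elim (¬al (inj₁ (∈T⁺ (qx , inj₁ (subst (_≤ 1) (sym (d-refl p)) z≤n)))))
    ...   | inj₂ (inj₁ px) = ⊥-elim (¬al (inj₁ (∈T⁺ (qx , inj₁ (subst (_≤ 1) (sym px) (s≤s z≤n))))))
    ...   | inj₂ (inj₂ px) = px , qx , λ adj → ¬al (inj₁ (∈T⁺ (qx , inj₂ adj)))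

    -- The part of c outside the ideal of S is the part beginning with q plus the part beginning
    -- with new vertices.  Up to the ideal of S it is the boundary of q ∷ B for B = e − g: the chain e lifts the new part
    -- along q, and g, supported on the colon ideal, corrects the error h.
    e : Vec V (suc k) → ℤ
    e (x ∷ r) = indicator (new? x) * c (x ∷ r)

    e-graded : Graded L′ q e
    e-graded (x ∷ r) ¬lies = indicator-*-zero (new? x) λ (px , qx , _) →
      gr (x ∷ r) λ ((_ , nr) , len∈L) → ¬lies
        ((positive⇒≢ qx , nr) ,
         subst L (trans (cong (_+ℕ len (x ∷ r)) px) (cong (λ m → suc (m +ℕ len (x ∷ r))) (sym qx))) len∈L)

    h : Vec V k → ℤ
    h r = c (q ∷ r) + 1ℤ * D q e r

    h-graded : Graded L′ q h
    h-graded r ¬lies = cong₂ (λ a b → a + 1ℤ * b)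
      (gr (q ∷ r) λ ((_ , nr) , len∈L) → ¬lies (nr , subst (λ m → L (m +ℕ len (q ∷ r))) pq len∈L))
      (D-graded L′ q e e-graded r ¬lies)

    -- Among the edges p → s with s ∈ q ∷ S, only p → q extends to a path to a new vertex.
    ins-new : ∀ {j} (c : Vec V (suc (suc j)) → ℤ) → SupportedOn p (q ∷ S) c →
      ∀ {x} → New x → ∀ r → ins p c x r ≡ c (q ∷ x ∷ r)
    ins-new c sup {x} (px , qx , ¬adj) r =
      trans (∑-allFin-single n q _ off) (indicator-yes-* (between? p q x) (pq , qx , px))
      where
      off : ∀ u → u ≢ q → w p u x * c (u ∷ x ∷ r) ≡ 0ℤ
      off u u≢q = indicator-*-zero (between? p u x) λ (pu , ux , _) → sup (u ∷ x ∷ r) λ where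
        (inj₁ (here u≡q))  → u≢q u≡q
        (inj₁ (there u∈S)) → ¬adj (lose u∈S ux)
        (inj₂ (pu≡2 , _))  → 1≢2 pu pu≡2

    h-supported : SupportedOn q T h
    h-supported []      ¬al = ⊥-elim (¬al tt)
    h-supported (x ∷ r) ¬al = split (q ≟F x)
      where
      drop : ∀ a b → a + 1ℤ * (0ℤ + -1ℤ * b) ≡ a + -1ℤ * b
      drop = solve-∀

      -- At a new `x`, `h (x ∷ r)` equals `D p c (x ∷ r)`: no merge creates the unit step `q → x`,
      -- `e` agrees with `c` behind `x`, and `ins-new` turns `c (q ∷ x ∷ r)` into the insertion
      -- term.
      vanishes : New x → h (x ∷ r) ≡ 0ℤ
      vanishes new@(_ , qx , _) =
        trans (cong (λ t → c (q ∷ x ∷ r) + 1ℤ * t) (cong₂ (λ a b → a + -1ℤ * b)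
                (∑-zero (allFin n) λ u → indicator-no-* (between? q u x) λ (_ , _ , qx≡2) → 1≢2 qx qx≡2)
                (D-cong x (λ s → indicator-yes-* (new? x) new) r)))
        (trans (drop (c (q ∷ x ∷ r)) (D x (c ∘ (x ∷_)) r))
        (trans (cong (_+ -1ℤ * D x (c ∘ (x ∷_)) r) (sym (ins-new c sup new r)))
               (cyc (x ∷ r))))

      split : Dec (q ≡ x) → h (x ∷ r) ≡ 0ℤ
      split (yes q≡x) = h-graded (x ∷ r) λ ((q≢x , _) , _) → q≢x q≡x
      split (no q≢x)  = vanishes (not-allowed-new q≢x ¬al)

    -- No merge creates the unit step `p → q`, so at `q ∷ r` only the differential behind `q`
    -- survives in `D p c`.
    cycle-head : ∀ {j} (c : Vec V (suc (suc j)) → ℤ) → (∀ r → D p c r ≡ 0ℤ) →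
      ∀ r → D q (c ∘ (q ∷_)) r ≡ 0ℤ
    cycle-head c cyc r =
      trans (negate (D q (c ∘ (q ∷_)) r))
      (cong (-1ℤ *_) (trans (cong (_+ -1ℤ * D q (c ∘ (q ∷_)) r) (sym
        (∑-zero (allFin n) λ u → indicator-no-* (between? p u q) λ (_ , _ , pq≡2) → 1≢2 pq pq≡2)))
        (cyc (q ∷ r))))
      where
      negate : ∀ a → a ≡ -1ℤ * (0ℤ + -1ℤ * a)
      negate = solve-∀

    h-cycle : Cycle q h
    -- `Cycle` is defined by cases on the degree, and `k` is a module parameter, so `go` generalises
    -- the degree.
    h-cycle = go k c e cyc
      where
      go : ∀ j (c e : Vec V (suc j) → ℤ) → Cycle p c → Cycle q (λ r → c (q ∷ r) + 1ℤ * D q e r)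
      go zero    c e cyc   = tt
      go (suc j) c e cyc r =
        trans (D-linear q (c ∘ (q ∷_)) (D q e) 1ℤ r)
              (cong₂ (λ a b → a + 1ℤ * b) (cycle-head c cyc r) (D∘D≡0 q e r))

    h-filling : Filling L′ q T h
    -- `¬ L′ k` is `¬ L (suc k)`: dropping the unit step `p → q` lowers degree and length together.
    h-filling = exact L′ ¬Lk q T (All-tabulate λ t∈T → proj₁ (∈T⁻ t∈T)) h h-graded
      h-supported h-cycle

    g : Vec V (suc k) → ℤ
    g = proj₁ h-filling

    g-graded : Graded L′ q g
    g-graded = proj₁ (proj₂ h-filling)

    g-supported : SupportedOn q T g
    g-supported = proj₁ (proj₂ (proj₂ h-filling))

    Dg≡h : ∀ r → D q g r ≡ h r
    Dg≡h = proj₂ (proj₂ (proj₂ h-filling))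

    B : Vec V (suc k) → ℤ
    B r = e r + -1ℤ * g r

    DB≡-c : ∀ r → D q B r ≡ -1ℤ * c (q ∷ r)
    DB≡-c r = trans (D-linear q e g -1ℤ r)
      (trans (cong (λ t → D q e r + -1ℤ * t) (Dg≡h r)) (cancel (D q e r) (c (q ∷ r))))
      where
      cancel : ∀ a b → a + -1ℤ * (b + 1ℤ * a) ≡ -1ℤ * b
      cancel = solve-∀

    b : Vec V (suc (suc k)) → ℤ
    b (u ∷ r) = indicator (q ≟F u) * B r

    b-graded : Graded L p b
    b-graded (u ∷ r) ¬lies = indicator-*-zero (q ≟F u) λ { refl →
      let ¬lies′ = λ (nr , len∈L) → ¬lies ((positive⇒≢ pq , nr) ,
                     subst (λ m → L (m +ℕ len (q ∷ r))) (sym pq) len∈L)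
      in cong₂ (λ a b → a + -1ℤ * b) (e-graded r ¬lies′) (g-graded r ¬lies′) }

    b-supported : SupportedOn p (q ∷ S) b
    b-supported (u ∷ r) ¬al = indicator-no-* (q ≟F u) λ { refl → ¬al (inj₁ (here refl)) }

    ins-b : ∀ x r → ins p b x r ≡ w p q x * B (x ∷ r)
    ins-b x r = trans
      (∑-allFin-single n q _ λ u u≢q →
        trans (cong (w p u x *_) (indicator-no-* (q ≟F u) (u≢q ∘ sym))) (*-zeroʳ (w p u x)))
      (cong (w p q x *_) (indicator-yes-* (q ≟F q) refl))

    rest : Vec V (suc k) → ℤ
    rest r = c r + -1ℤ * D p b r

    rest-graded : Graded L p rest
    rest-graded r ¬lies = cong₂ (λ a b → a + -1ℤ * b) (gr r ¬lies) (D-graded L p b b-graded r ¬lies)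

    rest-cycle : Cycle p rest
    rest-cycle r = trans (D-linear p c (D p b) -1ℤ r)
      (cong₂ (λ a b → a + -1ℤ * b) (cyc r) (D∘D≡0 p b r))

    Db-head : ∀ r → D p b (q ∷ r) ≡ c (q ∷ r)
    Db-head r = trans
      (cong₂ (λ a a′ → a + -1ℤ * a′)
        (trans (ins-b q r) (indicator-no-* (between? p q q) λ (_ , _ , pq≡2) → 1≢2 pq pq≡2))
        (trans (D-cong q (λ s → indicator-yes-* (q ≟F q) refl) r) (DB≡-c r)))
      (cancel (c (q ∷ r)))
      where
      cancel : ∀ a → 0ℤ + -1ℤ * (-1ℤ * a) ≡ a
      cancel = solve-∀

    Db-off-head : ∀ {x} → q ≢ x → ∀ r → D p b (x ∷ r) ≡ w p q x * B (x ∷ r)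
    Db-off-head {x} q≢x r = trans
      (cong₂ (λ a a′ → a + -1ℤ * a′) (ins-b x r) (D-zero x (λ s → indicator-no-* (q ≟F x) q≢x) r))
      (+-identityʳ (w p q x * B (x ∷ r)))

    -- There are three cases. At `q` this is `Db-head`; at a new vertex `e` contributes `c`, while
    -- `g` vanishes by its support; any other vertex lies outside the ideal of `q ∷ S` too, and both
    -- sides are zero.
    Db≡c : ∀ x r → ¬ Allowed p S x → D p b (x ∷ r) ≡ c (x ∷ r)
    Db≡c x r ¬al = split (q ≟F x)
      where
      wB≡c : q ≢ x → (btw? : Dec (Between p q x)) → indicator btw? * B (x ∷ r) ≡ c (x ∷ r)
      wB≡c q≢x (yes (_ , qx , px)) =
        trans (*-identityˡ (B (x ∷ r)))
        (trans (cong₂ (λ a b → a + -1ℤ * b) (indicator-yes-* (new? x) new)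
                 (g-supported (x ∷ r) (new-not-allowed new)))
               (+-identityʳ (c (x ∷ r))))
        where
        new : New x
        new = px , qx , λ adj → ¬al (inj₂ (px , adj))
      wB≡c q≢x (no ¬btw) = trans (*-zeroˡ (B (x ∷ r))) (sym (sup (x ∷ r) λ where
        (inj₁ (here x≡q))  → q≢x (sym x≡q)
        (inj₁ (there x∈S)) → ¬al (inj₁ x∈S)
        (inj₂ (px , here qx))   → ¬btw (pq , qx , px)
        (inj₂ (px , there adj)) → ¬al (inj₂ (px , adj))))

      split : Dec (q ≡ x) → D p b (x ∷ r) ≡ c (x ∷ r)
      split (yes refl) = Db-head r
      split (no q≢x)   = trans (Db-off-head q≢x r) (wB≡c q≢x (between? p q x))

    rest-supported : SupportedOn p S rest
    rest-supported (x ∷ r) ¬al =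
      trans (cong (λ t → c (x ∷ r) + -1ℤ * t) (Db≡c x r ¬al)) (cancel (c (x ∷ r)))
      where
      cancel : ∀ a → a + -1ℤ * a ≡ 0ℤ
      cancel = solve-∀

    combine : Filling L p S rest → Filling L p (q ∷ S) c
    combine (b′ , b′-graded , b′-supported , Db′≡rest) =
      (λ r → b r + 1ℤ * b′ r) ,
      (λ r ¬lies → cong₂ (λ a a′ → a + 1ℤ * a′) (b-graded r ¬lies) (b′-graded r ¬lies)) ,
      (λ r ¬al → cong₂ (λ a a′ → a + 1ℤ * a′) (b-supported r ¬al) (b′-supported r (¬al ∘ weaken r))) ,
      λ r → trans (D-linear p b b′ 1ℤ r)
        (trans (cong (λ t → D p b r + 1ℤ * t) (Db′≡rest r)) (cancel (D p b r) (c r)))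
      where
      weaken : ∀ {j} (r : Vec V j) → AllowedHead p S r → AllowedHead p (q ∷ S) r
      weaken []      _                 = tt
      weaken (x ∷ r) (inj₁ x∈S)        = inj₁ (there x∈S)
      weaken (x ∷ r) (inj₂ (px , adj)) = inj₂ (px , there adj)

      cancel : ∀ a b → a + 1ℤ * (b + -1ℤ * a) ≡ b
      cancel = solve-∀

  exact : ∀ k → Exact k
  exact zero L ¬L0 p S _ c gr sup cyc =
    zero-filling L p S c λ { [] → gr [] λ (_ , L0) → ¬L0 L0 }
  exact (suc k) L ¬Lk p [] _ c gr sup cyc =
    zero-filling L p [] c λ { (x ∷ r) → sup (x ∷ r) λ { (inj₁ ()) ; (inj₂ (_ , ())) } }
  exact (suc k) L ¬Lk p (q ∷ S) (pq ∷ pS) c gr sup cyc =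
    -- `Step` calls `exact k` on the set `T`, which may be larger than `S`; hence the degree is the
    -- outer induction.
    combine (exact (suc k) L ¬Lk p S pS rest rest-graded rest-supported rest-cycle)
    where open Step (exact k) L ¬Lk p q pq S c gr sup cyc

-- Identification of `∂` with `-1ℤ * D`, head by head.

module Comparison {n : ℕ} (d : Fin n → Fin n → ℕ)
  (d-sep : ∀ {x y} → d x y ≡ 0 → x ≡ y)
  (d-≤2 : ∀ x y → d x y ≤ 2)
  where

  open Magnitude d
  open Differential d

  ∑-allVecs-suc : ∀ m (f : Vec V (suc m) → ℤ) →
    ∑ (allVecs (suc m)) f ≡ ∑ (allVecs m) (λ v → ∑ (allFin n) (λ a → f (a ∷ v)))
  ∑-allVecs-suc m f =
    trans (∑-concatMap (allVecs m) (λ v → map (_∷ v) (allFin n)) f)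
          (∑-cong (allVecs m) λ v → ∑-map (allFin n) (_∷ v) f)

  ∑-allVecs-single : ∀ {m} (r : Vec V m) (f : Vec V m → ℤ) → (∀ v → v ≢ r → f v ≡ 0ℤ) →
    ∑ (allVecs m) f ≡ f r
  ∑-allVecs-single {zero}  []      f off = +-identityʳ (f [])
  ∑-allVecs-single {suc m} (x ∷ r) f off =
    trans (∑-allVecs-suc m f)
    (trans (∑-allVecs-single r _ λ v v≢r → ∑-zero (allFin n) λ a → off (a ∷ v) (v≢r ∘ ∷-injectiveʳ))
           (∑-allFin-single n x _ λ a a≢x → off (a ∷ r) (a≢x ∘ ∷-injectiveˡ)))

  ∑-allVecs-head : ∀ {m} p (f : Vec V (suc m) → ℤ) → (∀ a v → a ≢ p → f (a ∷ v) ≡ 0ℤ) →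
    ∑ (allVecs (suc m)) f ≡ ∑ (allVecs m) (f ∘ (p ∷_))
  ∑-allVecs-head {m} p f off =
    trans (∑-allVecs-suc m f) (∑-cong (allVecs m) λ v → ∑-allFin-single n p _ λ a → off a v)

  sign-suc : ∀ i → sign (suc i) ≡ -1ℤ * sign i
  sign-suc zero          = refl
  sign-suc (suc zero)    = refl
  sign-suc (suc (suc i)) = sign-suc i

  face? : ∀ {k} (j : Fin k) (x : Tuple (suc k)) (y : Tuple k) →
    Dec (len (removeAt x (suc (inject₁ j))) ≡ len x × removeAt x (suc (inject₁ j)) ≡ y)
  face? j x y = len (removeAt x (suc (inject₁ j))) ≟ℕ len x ×-dec ≡-dec _≟F_ (removeAt x (suc (inject₁ j))) y

  face-coeff-indicator : ∀ {k} (j : Fin k) x y → face-coeff j x y ≡ indicator (face? j x y)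
  face-coeff-indicator j x y with len (removeAt x (suc (inject₁ j))) ≟ℕ len x
                                ×-dec ≡-dec _≟F_ (removeAt x (suc (inject₁ j))) y
  ... | yes _ = refl
  ... | no  _ = refl

  -- A later deletion keeps the head and the first step, whose length `d a b` cancels from the two
  -- lengths compared.
  face-coeff-suc : ∀ {k} (j : Fin k) a (v : Tuple (suc k)) p (y : Tuple k) →
    face-coeff (suc j) (a ∷ v) (p ∷ y) ≡ indicator (a ≟F p) * face-coeff j v y
  face-coeff-suc j a v@(b ∷ _ ∷ _) p y =
    trans (face-coeff-indicator (suc j) (a ∷ v) (p ∷ y))
    (trans (indicator-cong (face? (suc j) (a ∷ v) (p ∷ y)) (a ≟F p ×-dec face? j v y)
      (λ (len≡ , rem≡) → ∷-injectiveˡ rem≡ , +-cancelˡ-≡ (d a b) _ _ len≡ , ∷-injectiveʳ rem≡)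
      (λ { (refl , len≡ , refl) → cong (d a b +ℕ_) len≡ , refl }))
    (trans (indicator-× (a ≟F p) (face? j v y))
           (cong (indicator (a ≟F p) *_) (sym (face-coeff-indicator j v y)))))

  -- Splits off the deletion next to the head; reindexing the others flips their signs. The factor
  -- `1ℤ` matches the form of `∑-linear`.
  ∂-coeff-suc : ∀ {k} a (v : Tuple (suc k)) p (y : Tuple k) →
    ∂-coeff (a ∷ v) (p ∷ y) ≡
    -1ℤ * (face-coeff zero (a ∷ v) (p ∷ y) + 1ℤ * (indicator (a ≟F p) * ∂-coeff v y))
  ∂-coeff-suc {k} a v p y =
    trans (∑-allFin-suc k (λ j → sign (suc (toℕ j)) * face-coeff j (a ∷ v) (p ∷ y)))
    (trans (cong (-1ℤ * face-coeff zero (a ∷ v) (p ∷ y) +_)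
      (trans (∑-cong (allFin k) λ j →
               trans (cong₂ _*_ (sign-suc (suc (toℕ j))) (face-coeff-suc j a v p y))
                     (shuffle (sign (suc (toℕ j))) (indicator (a ≟F p)) (face-coeff j v y)))
             (∑-scale (allFin k) _ (-1ℤ * indicator (a ≟F p)))))
      (factor (face-coeff zero (a ∷ v) (p ∷ y)) (indicator (a ≟F p)) (∂-coeff v y)))
    where
    shuffle : ∀ s i t → (-1ℤ * s) * (i * t) ≡ (-1ℤ * i) * (s * t)
    shuffle = solve-∀
    factor : ∀ t i e → -1ℤ * t + (-1ℤ * i) * e ≡ -1ℤ * (t + 1ℤ * (i * e))
    factor = solve-∀

  VanishesOnRepeats : ∀ {k} → (Tuple k → ℤ) → Set
  VanishesOnRepeats f = ∀ x → ¬ NoRepeat x → f x ≡ 0ℤ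

  -- Two positive distances with sum at most 2 are both 1. Hence, without repeats, only merges of
  -- two unit steps give nonzero faces.
  additive⇒between : ∀ {p u x} → p ≢ u → u ≢ x → d p x ≡ d p u +ℕ d u x → Between p u x
  additive⇒between {p} {u} {x} p≢u u≢x eq with d p u in pu | d u x in ux | d-≤2 p x
  ... | zero | _ | _ = ⊥-elim (p≢u (d-sep pu))
  ... | suc _ | zero | _ = ⊥-elim (u≢x (d-sep ux))
  ... | 1 | 1 | _ = refl , refl , eq
  ... | 1 | suc (suc _) | ≤2 with s≤s (s≤s ()) ← subst (_≤ 2) eq ≤2
  ... | suc (suc i) | suc j | ≤2
    with s≤s (s≤s le) ← subst (_≤ 2) eq ≤2
    with () ← trans (sym (+-suc i j)) (n≤0⇒n≡0 le)

  -- If `u` equals `p` or `x`, deleting it preserves length although `w p u x` is 0 for a metric;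
  -- the sides then agree because `f` vanishes there.
  first-face : ∀ {k} (f : Tuple (suc (suc k)) → ℤ) → VanishesOnRepeats f → ∀ p u x (r : Vec V k) →
    f (p ∷ u ∷ x ∷ r) * face-coeff zero (p ∷ u ∷ x ∷ r) (p ∷ x ∷ r) ≡ w p u x * f (p ∷ u ∷ x ∷ r)
  first-face f van p u x r = split (p ≟F u) (u ≟F x)
    where
    z : Tuple _
    z = p ∷ u ∷ x ∷ r

    ℓ : ℕ
    ℓ = len (x ∷ r)

    repeated : ¬ NoRepeat z → f z * face-coeff zero z (p ∷ x ∷ r) ≡ w p u x * f z
    repeated rep = trans (cong (_* face-coeff zero z (p ∷ x ∷ r)) (van z rep))
      (trans (*-zeroˡ (face-coeff zero z (p ∷ x ∷ r)))
      (sym (trans (cong (w p u x *_) (van z rep)) (*-zeroʳ (w p u x)))))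

    split : Dec (p ≡ u) → Dec (u ≡ x) → f z * face-coeff zero z (p ∷ x ∷ r) ≡ w p u x * f z
    split (yes p≡u) _         = repeated λ (p≢u , _) → p≢u p≡u
    split (no _)    (yes u≡x) = repeated λ (_ , u≢x , _) → u≢x u≡x
    split (no p≢u)  (no u≢x)  =
      trans (*-comm (f z) _) (cong (_* f z)
        (trans (face-coeff-indicator zero z (p ∷ x ∷ r))
          (indicator-cong (face? zero z (p ∷ x ∷ r)) (between? p u x)
            (λ (len≡ , _) → additive⇒between p≢u u≢x
              (+-cancelʳ-≡ ℓ _ _ (trans len≡ (sym (+-assoc (d p u) (d u x) ℓ)))))
            (λ (pu , ux , px) →
              trans (cong (_+ℕ ℓ) px) (sym (cong₂ (λ a b → a +ℕ (b +ℕ ℓ)) pu ux)) , refl))))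

  first-faces : ∀ {k} (f : Tuple (suc (suc k)) → ℤ) → VanishesOnRepeats f → ∀ p x (r : Vec V k) →
    ∑ (allVecs (suc (suc (suc k)))) (λ z → f z * face-coeff zero z (p ∷ x ∷ r)) ≡ ins p (f ∘ (p ∷_)) x r
  first-faces {k} f van p x r =
    trans (∑-allVecs-head p F λ { a (u ∷ v) a≢p → off a u v λ eq → a≢p (∷-injectiveˡ eq) })
    (trans (∑-allVecs-suc (suc k) (F ∘ (p ∷_)))
    (trans (∑-allVecs-single (x ∷ r) _ λ v v≢ → ∑-zero (allFin n) λ u → off p u v λ eq → v≢ (∷-injectiveʳ eq))
           (∑-cong (allFin n) λ u → first-face f van p u x r)))
    where
    F : Tuple (suc (suc k)) → ℤ
    F z = f z * face-coeff zero z (p ∷ x ∷ r)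

    off : ∀ a u (v : Vec V (suc k)) → a ∷ v ≢ p ∷ x ∷ r → F (a ∷ u ∷ v) ≡ 0ℤ
    off a u v ne = trans
      (cong (f (a ∷ u ∷ v) *_) (trans (face-coeff-indicator zero (a ∷ u ∷ v) (p ∷ x ∷ r))
        (indicator-no (face? zero (a ∷ u ∷ v) (p ∷ x ∷ r)) λ (_ , eq) → ne eq)))
      (*-zeroʳ (f (a ∷ u ∷ v)))

  -- By induction on `r`: deletions next to the head give `ins`, and later ones keep `p`, so they
  -- form the same sum for `f ∘ (p ∷_)` with head `x`.
  ∂≡-D : ∀ {k} (f : Tuple (suc k) → ℤ) → VanishesOnRepeats f → ∀ p (r : Vec V k) →
    ∑ (allVecs (suc (suc k))) (λ z → f z * ∂-coeff z (p ∷ r)) ≡ -1ℤ * D p (f ∘ (p ∷_)) r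
  ∂≡-D f van p [] = ∑-zero (allVecs 2) λ z → *-zeroʳ (f z)
  ∂≡-D {suc k} f van p (x ∷ r) =
    trans (∑-cong (allVecs (suc (suc (suc k)))) λ { (a ∷ v) →
      trans (cong (f (a ∷ v) *_) (∂-coeff-suc a v p (x ∷ r)))
            (distrib (f (a ∷ v)) (face-coeff zero (a ∷ v) (p ∷ x ∷ r)) (indicator (a ≟F p) * ∂-coeff v (x ∷ r))) })
    (trans (∑-scale (allVecs (suc (suc (suc k)))) (λ z → f z * face-coeff zero z (p ∷ x ∷ r) + 1ℤ * later z) -1ℤ)
    (cong (-1ℤ *_)
      (trans (∑-linear (allVecs (suc (suc (suc k)))) (λ z → f z * face-coeff zero z (p ∷ x ∷ r)) later 1ℤ)
      (trans (cong₂ (λ a b → a + 1ℤ * b) (first-faces f van p x r) later-faces)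
             (cong (ins p (f ∘ (p ∷_)) x r +_) (*-identityˡ _))))))
    where
    distrib : ∀ f a b → f * (-1ℤ * (a + 1ℤ * b)) ≡ -1ℤ * (f * a + 1ℤ * (f * b))
    distrib = solve-∀

    later : Tuple (suc (suc k)) → ℤ
    later (a ∷ v) = f (a ∷ v) * (indicator (a ≟F p) * ∂-coeff v (x ∷ r))

    later-faces : ∑ (allVecs (suc (suc (suc k)))) later ≡ -1ℤ * D x (λ s → f (p ∷ x ∷ s)) r
    later-faces =
      trans (∑-allVecs-head p later λ a v a≢p →
              trans (cong (f (a ∷ v) *_) (indicator-no-* (a ≟F p) a≢p)) (*-zeroʳ (f (a ∷ v))))
      (trans (∑-cong (allVecs (suc (suc k))) λ v → cong (f (p ∷ v) *_) (indicator-yes-* (p ≟F p) refl))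
             (∂≡-D (f ∘ (p ∷_)) (λ { (_ ∷ _) rep → van _ λ (_ , nr) → rep nr }) x r))

-- Metric properties of the shortest-path distance.

module ShortestPaths (G : SimpleGraph)
  (d : Fin (SimpleGraph.n G) → Fin (SimpleGraph.n G) → ℕ) (metric : IsShortestPathMetric G d)
  where

  open SimpleGraph G

  d-refl : ∀ x → d x x ≡ 0
  d-refl x = n≤0⇒n≡0 (proj₂ (metric x x) 0 here)

  d-sep : ∀ {x y} → d x y ≡ 0 → x ≡ y
  d-sep {x} {y} eq with here ← subst (Walk G x y) eq (proj₁ (metric x y)) = refl

  _∷ʳ_ : ∀ {x y z m} → Walk G x y m → Adj y z → Walk G x z (suc m)
  here     ∷ʳ a = step a here
  step b t ∷ʳ a = step b (t ∷ʳ a)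

  reverse : ∀ {x y m} → Walk G x y m → Walk G y x m
  reverse here       = here
  reverse (step a t) = reverse t ∷ʳ Adj-sym a

  d-sym : ∀ x y → d x y ≡ d y x
  d-sym x y = ≤-antisym (proj₂ (metric x y) _ (reverse (proj₁ (metric y x))))
                        (proj₂ (metric y x) _ (reverse (proj₁ (metric x y))))

  adjacent⇒d≡1 : ∀ {x y} → Adj x y → d x y ≡ 1
  adjacent⇒d≡1 {x} {y} a with d x y in eq | proj₂ (metric x y) 1 (step a here)
  ... | 0           | _ with refl ← d-sep eq = ⊥-elim (Adj-irrefl a)
  ... | 1           | _ = refl
  ... | suc (suc _) | s≤s ()

  midpoint : ∀ {x y} → d x y ≡ 2 → ∃ λ m → d x m ≡ 1 × d m y ≡ 1
  midpoint {x} {y} eq with step a (step b here) ← subst (Walk G x y) eq (proj₁ (metric x y)) =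
    _ , adjacent⇒d≡1 a , adjacent⇒d≡1 b

-- Assembly of the fillings over all heads.

theorem4p4 : (G : SimpleGraph) (d : Fin (SimpleGraph.n G) → Fin (SimpleGraph.n G) → ℕ) →
    IsShortestPathMetric G d → Pawful d → Magnitude.Diagonal d
theorem4p4 G d metric pawful k l k≢l (c , c-graded) cycle =
  (b , b-graded) , λ { (p ∷ r) →
    trans (∂≡-D b (λ x rep → b-graded x (rep ∘ proj₁)) p r)
    (trans (cong (-1ℤ *_) (D-scale p (proj₁ (filling p)) -1ℤ r))
    (trans (involutive (D p (proj₁ (filling p)) r)) (proj₂ (proj₂ (proj₂ (filling p))) r))) }
  where
  open SimpleGraph G using (n)
  open ShortestPaths G d metric
  open Magnitude d
  open Differential d
  open Contraction d d-refl d-sep d-sym pawful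
  open Comparison d d-sep (proj₁ pawful)

  involutive : ∀ a → -1ℤ * (-1ℤ * a) ≡ a
  involutive = solve-∀

  neighbours : V → List V
  neighbours p = filter (λ s → d p s ≟ℕ 1) (allFin n)

  neighbours-adjacent : ∀ p → All (λ s → d p s ≡ 1) (neighbours p)
  neighbours-adjacent p = All-tabulate λ s∈ → proj₂ (∈-filter⁻ (λ s → d p s ≟ℕ 1) {xs = allFin n} s∈)

  -- All neighbours together generate every `p → x` with `x ≢ p`: a vertex at distance 2 is reached
  -- through a midpoint.
  supported : ∀ p {k} (f : Vec V k → ℤ) → Graded (_≡ l) p f → SupportedOn p (neighbours p) f
  supported p f gr []      ¬al = ⊥-elim (¬al tt)
  supported p f gr (x ∷ r) ¬al with distance p x
  ... | inj₁ p≡x = gr (x ∷ r) λ ((p≢x , _) , _) → p≢x p≡x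
  ... | inj₂ (inj₁ px) = ⊥-elim (¬al (inj₁ (∈-filter⁺ (λ s → d p s ≟ℕ 1) (∈-allFin x) px)))
  ... | inj₂ (inj₂ px) with m , pm , mx ← midpoint px =
    ⊥-elim (¬al (inj₂ (px , lose (∈-filter⁺ (λ s → d p s ≟ℕ 1) (∈-allFin m) pm) mx)))

  cycle-at : ∀ k (c : Chain k l) → IsCycle c → ∀ p → Cycle p (coeff c ∘ (p ∷_))
  cycle-at zero    c        cyc p   = tt
  cycle-at (suc k) (f , gr) cyc p r =
    trans (sym (involutive _))
          (cong (-1ℤ *_) (trans (sym (∂≡-D f (λ x rep → gr x (rep ∘ proj₁)) p r)) (cyc (p ∷ r))))

  filling : ∀ p → Filling (_≡ l) p (neighbours p) (c ∘ (p ∷_))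
  -- For `L` equal to `_≡ l`, the hypothesis `k≢l` is exactly `¬ L k`.
  filling p = exact k (_≡ l) k≢l p (neighbours p) (neighbours-adjacent p) (c ∘ (p ∷_)) graded
    (supported p (c ∘ (p ∷_)) graded) (cycle-at k (c , c-graded) cycle p)
    where
    graded : Graded (_≡ l) p (c ∘ (p ∷_))
    graded r = c-graded (p ∷ r)

  b : Tuple (suc k) → ℤ
  -- Since `∂` preserves heads, each head is filled separately; the sign offsets the one in `∂≡-D`.
  b (p ∷ r) = -1ℤ * proj₁ (filling p) r

  b-graded : ∀ x → ¬ Gen (suc k) l x → b x ≡ 0ℤ
  b-graded (p ∷ r) ¬gen = cong (-1ℤ *_) (proj₁ (proj₂ (filling p)) r ¬gen)
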